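{- Let $T$ be a complete binary tree with $n$ leaves (so $n-1$ internal nodes), and let $I^*$ be the multiset of internal nodes of $T$ in which the root appears twice (so $|I^*| = n$). Let $\Pi$ be a bijection from the set of leaves of $T$ onto $I^*$, chosen uniformly at random among all $n!$ such bijections, and let $G_\Pi$ be the graph obtained from $T$ by contracting each pair $(v,\Pi(v))$, $v$ a leaf. Then, with probability $1-o(1)$ as $n\to\infty$, the node expansion of $G_\Pi$ is at least $\frac{1}{480}$; that is, every set $S$ of vertices of $G_\Pi$ with $|S|\le n/2$ satisfies $|\partial S|\ge |S|/480$.
   Context: The duplicated root is regarded as identical to the original root (in particular it has the same neighbors in $T$ as the root). The contraction of $(v,\Pi(v))$ means contracting the edge $\{v,\Pi(v)\}$ as if it existed in $T$; thus $G_\Pi$ has one vertex for each leaf $v$ of $T$ (representing the pair $\{v,\Pi(v)\}$), so $G_\Pi$ has $n$ vertices, and two such vertices are adjacent if some node of one pair is adjacent in $T$ to some node of the other pair. For an undirected graph $G=(V_G,E_G)$ and $S\subseteq V_G$, the node boundary $\partial S$ is the set of vertices not in $S$ that are adjacent to at least one vertex of $S$, and the node expansion is $h(G)=\min_{S\subseteq V_G,\ |S|\le |V_G|/2} |\partial S|/|S|$. -}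

module Defs where

open import Data.Nat.Base using (ℕ; zero; suc; _+_; _*_; _≤ᵇ_; _≡ᵇ_; ⌊_/2⌋)
open import Data.Bool.Base using (Bool; true; false; _∧_; _∨_; not; if_then_else_)
open import Data.Fin.Base using (Fin; toℕ)
open import Data.Fin.Subset using (Subset; ∣_∣)
open import Data.Vec.Base using (Vec; []; _∷_; lookup; tabulate)
open import Data.List.Base as L using (List; []; _∷_; allFin; concatMap; filter; length)
open import Data.Bool.ListAction using (any; all)
open import Relation.Nullary.Decidable using (T?)

-- Complete binary tree T with n leaves, heap numbering: nodes 1 .. 2n-1,
-- node k has children 2k and 2k+1.  Internal nodes: 1 .. n-1 (root = 1),
-- leaves: n .. 2n-1.
-- a is the parent of b in T
isParent : ℕ → ℕ → Bool
isParent a b = (2 ≤ᵇ b) ∧ (a ≡ᵇ ⌊ b /2⌋)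

treeAdj : ℕ → ℕ → Bool
treeAdj a b = isParent a b ∨ isParent b a

leafNode : (n : ℕ) → Fin n → ℕ
leafNode n i = n + toℕ i

-- I* as n slots: slot 0 and slot 1 are the two copies of the root (node 1),
-- slot j (2 ≤ j ≤ n-1) is internal node j.  Both root copies are the node 1
-- of T (same neighbours).
slotNode : {n : ℕ} → Fin n → ℕ
slotNode j = if toℕ j ≡ᵇ 0 then 1 else toℕ j

-- A map Π : leaves → I*, given as a vector of slots
Map : ℕ → Set
Map n = Vec (Fin n) n

pairNodes : {n : ℕ} → Map n → Fin n → List ℕ
pairNodes {n} Π i = leafNode n i ∷ slotNode (lookup Π i) ∷ []

_==_ : {n : ℕ} → Fin n → Fin n → Bool
i == j = toℕ i ≡ᵇ toℕ j

-- adjacency in the contracted graph G_Π (vertex set Fin n, one per pair)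
gAdj : {n : ℕ} → Map n → Fin n → Fin n → Bool
gAdj Π i j = not (i == j) ∧
  any (λ a → any (λ b → treeAdj a b) (pairNodes Π j)) (pairNodes Π i)

boundary : {n : ℕ} → Map n → Subset n → Subset n
boundary {n} Π S = tabulate λ j →
  not (lookup S j) ∧ any (λ i → lookup S i ∧ gAdj Π i j) (allFin n)

allSubsets : (n : ℕ) → List (Subset n)
allSubsets zero = [] ∷ []
allSubsets (suc n) = concatMap (λ s → (true ∷ s) ∷ (false ∷ s) ∷ []) (allSubsets n)

expansionAtLeast1/480 : {n : ℕ} → Map n → Bool
expansionAtLeast1/480 {n} Π = all (λ S →
    not (2 * ∣ S ∣ ≤ᵇ n) ∨ (∣ S ∣ ≤ᵇ 480 * ∣ boundary Π S ∣))
  (allSubsets n)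

allVecs : (m n : ℕ) → List (Vec (Fin n) m)
allVecs zero n = [] ∷ []
allVecs (suc m) n = concatMap (λ v → L.map (λ x → x ∷ v) (allFin n)) (allVecs m n)

isBijection : {n : ℕ} → Map n → Bool
isBijection {n} Π = all (λ i → all (λ j → (i == j) ∨ not (lookup Π i == lookup Π j))
  (allFin n)) (allFin n)

badCount : ℕ → ℕ
badCount n = length (filter (λ Π → T? (isBijection Π ∧ not (expansionAtLeast1/480 Π)))
  (allVecs n n))

module Submission where

open import Defs
open import Algebra.Properties.CommutativeSemigroup using (interchange)
open import Data.Bool.Base using (Bool; true; false; _∧_; _∨_; not; _xor_; if_then_else_; T)
open import Data.Bool.ListAction using (any; all)
open import Data.Bool.Properties as Bool using (¬-not; T-≡)
open import Data.Fin.Base as F using (Fin; toℕ)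
import Data.Fin.Properties as F
open import Data.Fin.Subset using (Subset; ∣_∣)
open import Data.List.Base as L using (List; []; _∷_; allFin; concatMap; filter; length; downFrom)
open import Data.List.Membership.Propositional using (_∈_)
open import Data.List.Membership.Propositional.Properties using (∈-allFin)
import Data.List.Properties as L
open import Data.List.Relation.Unary.Any using (here; there)
open import Data.Nat.Base
open import Data.Nat.Combinatorics
open import Data.Nat.DivMod using (m/n*n≡m)
open import Data.Nat.Induction using (<-rec)
open import Data.Nat.ListAction using (sum)
open import Data.Nat.Properties
open import Data.Nat.Tactic.RingSolver using (solve-∀)
open import Data.Product using (∃-syntax; _×_; _,_)
open import Data.Sum.Base using (_⊎_; inj₁; inj₂)
open import Data.Vec.Base using (Vec; []; _∷_; lookup; tabulate)
open import Data.Vec.Properties using (lookup∘tabulate; tabulate∘lookup; tabulate-cong)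
open import Function.Base using (_∘_)
open import Function.Bundles using (Equivalence)
open import Relation.Binary.PropositionalEquality
open import Relation.Nullary.Decidable using (T?; yes; no)
open import Relation.Nullary.Negation using (¬_; contradiction)

-- Number the slots 0 … 2n-1: leaf i is n + i, the internal slots are 0 … n-1, and the parent of
-- x ≥ 2 is ⌊ x /2⌋.  A set S of s pairs colours the slots, and each x whose colour differs from
-- that of its parent has itself or its parent in a boundary pair; each boundary pair meets at most
-- four such x.  With d boundary pairs there are thus z ≤ 4d + 2 flips (two for the slots 0 and 1),
-- and the flips determine the colouring, so at most C(2n, z) colourings have z flips.  A colouring
-- with s leaves fits at most s! (n - s)! = n! / C(n, s) bijections.  If the expansion fails for S,
-- then d ≥ 1 by connectivity, so z is small compared to s, and C(n, s) ≥ C(n, 2(z + 1)) exceeds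
-- C(2n, z) by a factor of at least C(n, 2), of order n².  Summing over z ≤ 2n, the proportion of
-- bad bijections is O(1/n).

private variable
  A B : Set
  m n : ℕ

-- Indicators and finite sums.

⟦_⟧ : Bool → ℕ
⟦ true ⟧ = 1
⟦ false ⟧ = 0

∑ : List A → (A → ℕ) → ℕ
∑ xs f = sum (L.map f xs)

∑-cong : {f g : A → ℕ} (xs : List A) → (∀ x → f x ≡ g x) → ∑ xs f ≡ ∑ xs g
∑-cong xs f≡g = cong sum (L.map-cong f≡g xs)

∑-mono : {f g : A → ℕ} (xs : List A) → (∀ x → f x ≤ g x) → ∑ xs f ≤ ∑ xs g
∑-mono []       f≤g = z≤n
∑-mono (x ∷ xs) f≤g = +-mono-≤ (f≤g x) (∑-mono xs f≤g)

∑-zero : {f : A → ℕ} (xs : List A) → (∀ x → f x ≡ 0) → ∑ xs f ≡ 0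
∑-zero []       f≡0 = refl
∑-zero (x ∷ xs) f≡0 = cong₂ _+_ (f≡0 x) (∑-zero xs f≡0)

∑-+ : (xs : List A) (f g : A → ℕ) → ∑ xs (λ x → f x + g x) ≡ ∑ xs f + ∑ xs g
∑-+ []       f g = refl
∑-+ (x ∷ xs) f g = trans (cong (f x + g x +_) (∑-+ xs f g))
  (interchange +-commutativeSemigroup (f x) (g x) _ _)

∑-*ˡ : (xs : List A) (c : ℕ) (f : A → ℕ) → ∑ xs (λ x → c * f x) ≡ c * ∑ xs f
∑-*ˡ []       c f = sym (*-zeroʳ c)
∑-*ˡ (x ∷ xs) c f = trans (cong (c * f x +_) (∑-*ˡ xs c f)) (sym (*-distribˡ-+ c (f x) _))

∑-*ʳ : (xs : List A) (c : ℕ) (f : A → ℕ) → ∑ xs (λ x → f x * c) ≡ ∑ xs f * c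
∑-*ʳ xs c f = trans (∑-cong xs (λ x → *-comm (f x) c)) (trans (∑-*ˡ xs c f) (*-comm c _))

∑-swap : (xs : List A) (ys : List B) (f : A → B → ℕ) →
         ∑ xs (λ x → ∑ ys (f x)) ≡ ∑ ys (λ y → ∑ xs (λ x → f x y))
∑-swap []       ys f = sym (∑-zero ys (λ _ → refl))
∑-swap (x ∷ xs) ys f = trans (cong (∑ ys (f x) +_) (∑-swap xs ys f)) (sym (∑-+ ys _ _))

∑-++ : (xs ys : List A) (f : A → ℕ) → ∑ (xs L.++ ys) f ≡ ∑ xs f + ∑ ys f
∑-++ []       ys f = refl
∑-++ (x ∷ xs) ys f = trans (cong (f x +_) (∑-++ xs ys f)) (sym (+-assoc (f x) _ _))

∑-concatMap : (xs : List A) (g : A → List B) (f : B → ℕ) →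
              ∑ (concatMap g xs) f ≡ ∑ xs (λ x → ∑ (g x) f)
∑-concatMap []       g f = refl
∑-concatMap (x ∷ xs) g f =
  trans (∑-++ (g x) (concatMap g xs) f) (cong (∑ (g x) f +_) (∑-concatMap xs g f))

∑-map : (xs : List A) (g : A → B) (f : B → ℕ) → ∑ (L.map g xs) f ≡ ∑ xs (f ∘ g)
∑-map xs g f = cong sum (sym (L.map-∘ xs))

∑-allFin-suc : (f : Fin (suc n) → ℕ) → ∑ (allFin (suc n)) f ≡ f F.zero + ∑ (allFin n) (f ∘ F.suc)
∑-allFin-suc {n} f = cong (λ l → f F.zero + sum l)
  (trans (L.map-tabulate F.suc f) (sym (L.map-tabulate (λ i → i) (f ∘ F.suc))))

∑-allSubsets-suc : ∀ m (f : Subset (suc m) → ℕ) →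
  ∑ (allSubsets (suc m)) f ≡ ∑ (allSubsets m) (λ X → f (true ∷ X) + f (false ∷ X))
∑-allSubsets-suc m f = trans (∑-concatMap (allSubsets m) _ f)
  (∑-cong (allSubsets m) (λ X → cong (f (true ∷ X) +_) (+-identityʳ _)))

∑-allVecs-suc : ∀ m n (f : Vec (Fin n) (suc m) → ℕ) →
  ∑ (allVecs (suc m) n) f ≡ ∑ (allVecs m n) (λ v → ∑ (allFin n) (λ x → f (x ∷ v)))
∑-allVecs-suc m n f = trans (∑-concatMap (allVecs m n) _ f)
  (∑-cong (allVecs m n) (λ v → ∑-map (allFin n) (_∷ v) f))

term≤∑-allSubsets : (X : Subset m) (f : Subset m → ℕ) → f X ≤ ∑ (allSubsets m) f
term≤∑-allSubsets []          f = m≤m+n _ 0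
term≤∑-allSubsets {suc m} (true ∷ X)  f = ≤-trans (m≤m+n _ _)
  (≤-trans (term≤∑-allSubsets X _) (≤-reflexive (sym (∑-allSubsets-suc m f))))
term≤∑-allSubsets {suc m} (false ∷ X) f = ≤-trans (m≤n+m _ (f (true ∷ X)))
  (≤-trans (term≤∑-allSubsets X _) (≤-reflexive (sym (∑-allSubsets-suc m f))))

length-filter≡∑ : (p : A → Bool) (xs : List A) → length (filter (λ x → T? (p x)) xs) ≡ ∑ xs (⟦_⟧ ∘ p)
length-filter≡∑ p []       = refl
length-filter≡∑ p (x ∷ xs) with p x
... | true  = cong suc (length-filter≡∑ p xs)
... | false = length-filter≡∑ p xs

∑-downFrom-mono : {f g : ℕ → ℕ} → ∀ m → (∀ x → x < m → f x ≤ g x) → ∑ (downFrom m) f ≤ ∑ (downFrom m) g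
∑-downFrom-mono zero    f≤g = z≤n
∑-downFrom-mono (suc m) f≤g =
  +-mono-≤ (f≤g m ≤-refl) (∑-downFrom-mono m (λ x x<m → f≤g x (m<n⇒m<1+n x<m)))

∑-downFrom-const : ∀ m c → ∑ (downFrom m) (λ _ → c) ≡ m * c
∑-downFrom-const zero    c = refl
∑-downFrom-const (suc m) c = cong (c +_) (∑-downFrom-const m c)

term≤∑-downFrom : ∀ {a m} (f : ℕ → ℕ) → a < m → f a ≤ ∑ (downFrom m) f
term≤∑-downFrom {a} {suc m} f a<1+m with a ≟ m
... | yes refl = m≤m+n (f a) _
... | no  a≢m  = ≤-trans (term≤∑-downFrom f (≤∧≢⇒< (s≤s⁻¹ a<1+m) a≢m)) (m≤n+m _ (f m))

≡ᵇ-refl : ∀ a → (a ≡ᵇ a) ≡ true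
≡ᵇ-refl zero    = refl
≡ᵇ-refl (suc a) = ≡ᵇ-refl a

≡ᵇ-true : ∀ a b → (a ≡ᵇ b) ≡ true → a ≡ b
≡ᵇ-true a b eq = ≡ᵇ⇒≡ a b (subst T (sym eq) _)

≢⇒≡ᵇ-false : ∀ {a b} → a ≢ b → (a ≡ᵇ b) ≡ false
≢⇒≡ᵇ-false {a} {b} a≢b = ¬-not (a≢b ∘ ≡ᵇ-true a b)

∑-downFrom-≡ᵇ : ∀ a m → ∑ (downFrom m) (λ x → ⟦ a ≡ᵇ x ⟧) ≤ 1
∑-downFrom-≡ᵇ a zero    = z≤n
∑-downFrom-≡ᵇ a (suc m) with a ≟ m
... | no  a≢m rewrite ≢⇒≡ᵇ-false a≢m = ∑-downFrom-≡ᵇ a m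
... | yes refl rewrite ≡ᵇ-refl a =
  s≤s (≤-trans (∑-downFrom-mono a λ x x<a → ≤-reflexive (cong ⟦_⟧ (≢⇒≡ᵇ-false (>⇒≢ x<a))))
               (≤-reflexive (trans (∑-downFrom-const a 0) (*-zeroʳ a))))

-- Binomial coefficients: growth and comparison.

nC0≡1 : ∀ n → n C 0 ≡ 1
nC0≡1 n = trans (nCk≡nC[n∸k] {0} {n} z≤n) (nCn≡1 n)

-- This is (k+1) C(n,k+1) = (n-k) C(n,k) with the subtraction moved to the other side, so that it
-- holds in ℕ for all `n` and `k`. It follows from Pascal's rule by induction.
C-absorption : ∀ n k → suc k * (n C suc k) + k * (n C k) ≡ n * (n C k)
C-absorption zero    k
  rewrite k>n⇒nCk≡0 {0} {suc k} z<s | *-zeroʳ k with k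
... | zero  = refl
... | suc k rewrite k>n⇒nCk≡0 {0} {suc k} z<s = *-zeroʳ k
C-absorption (suc n) zero
  rewrite nC1≡n (suc n) | nC0≡1 (suc n) = base n
  where
  base : ∀ n → suc n + 0 + 0 ≡ suc n * 1
  base = solve-∀
C-absorption (suc n) (suc k)
  rewrite sym (nCk+nC[k+1]≡[n+1]C[k+1] n (suc k)) | sym (nCk+nC[k+1]≡[n+1]C[k+1] n k) =
  trans (regroup k (n C k) (n C suc k) (n C suc (suc k)))
    (trans (cong₂ (λ u v → u + v + (n C k + n C suc k)) (C-absorption n (suc k)) (C-absorption n k))
           (collect n (n C k) (n C suc k)))
  where
  regroup : ∀ k a b c → suc (suc k) * (b + c) + suc k * (a + b)
    ≡ (suc (suc k) * c + suc k * b) + (suc k * b + k * a) + (a + b)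
  regroup = solve-∀
  collect : ∀ n a b → n * b + n * a + (a + b) ≡ suc n * (a + b)
  collect = solve-∀

C-factorial : ∀ {n k} → k ≤ n → (n C k) * (k ! * (n ∸ k) !) ≡ n !
C-factorial {n} {k} k≤n = trans (cong (_* (k ! * (n ∸ k) !)) (nCk≡n!/k![n-k]! k≤n))
  (m/n*n≡m {{k !* (n ∸ k) !≢0}} (k![n∸k]!∣n! k≤n))

C-nonZero : ∀ {n k} → k ≤ n → NonZero (n C k)
C-nonZero {n} {k} k≤n = ≢-nonZero λ eq →
  ≢-nonZero⁻¹ (n !) {{n !≢0}} (trans (sym (C-factorial k≤n)) (cong (_* (k ! * (n ∸ k) !)) eq))

-- The ratio of the two coefficients is (n-k)/(k+1), which is at least 1 as long as 2k + 1 ≤ n.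
C-step : ∀ {n k} → 2 * k < n → n C k ≤ n C suc k
C-step {n} {k} 2k<n = *-cancelˡ-≤ (suc k) (+-cancelʳ-≤ (k * (n C k)) _ _ (begin
  suc k * (n C k) + k * (n C k)         ≡⟨ *-distribʳ-+ (n C k) (suc k) k ⟨
  (suc k + k) * (n C k)                 ≤⟨ *-monoˡ-≤ (n C k) (subst (λ l → suc (k + l) ≤ n) (+-identityʳ k) 2k<n) ⟩
  n * (n C k)                           ≡⟨ C-absorption n k ⟨
  suc k * (n C suc k) + k * (n C k)     ∎))
  where open ≤-Reasoning

C-mono : ∀ {n a b} → a ≤′ b → 2 * b ≤ n → n C a ≤ n C b
C-mono ≤′-refl        _    = ≤-refl
C-mono {b = suc b} (≤′-step a≤b) 2b≤n =
  ≤-trans (C-mono a≤b (<⇒≤ 2b<n)) (C-step 2b<n)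
  where 2b<n = ≤-trans (*-monoʳ-< 2 (n<1+n b)) 2b≤n

-- In the ratio (n-k)/(k+1) the numerator is at least n/2.
C-half : ∀ {n k} → 2 * k ≤ n → n * (n C k) ≤ 2 * (suc k * (n C suc k))
C-half {n} {k} 2k≤n = +-cancelʳ-≤ (n * (n C k)) _ _ (begin
  n * (n C k) + n * (n C k)                         ≡⟨ double (n * (n C k)) ⟩
  2 * (n * (n C k))                                 ≡⟨ cong (2 *_) (C-absorption n k) ⟨
  2 * (suc k * (n C suc k) + k * (n C k))           ≡⟨ spread (suc k * (n C suc k)) k (n C k) ⟩
  2 * (suc k * (n C suc k)) + (2 * k) * (n C k)     ≤⟨ +-monoʳ-≤ (2 * (suc k * (n C suc k))) (*-monoˡ-≤ (n C k) 2k≤n) ⟩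
  2 * (suc k * (n C suc k)) + n * (n C k)           ∎)
  where
  open ≤-Reasoning
  double : ∀ a → a + a ≡ 2 * a
  double = solve-∀
  spread : ∀ a k b → 2 * (a + k * b) ≡ 2 * a + (2 * k) * b
  spread = solve-∀

-- Raising z by one multiplies the left side by at most 2n/(z+1) and the right side by at least
-- (n/2)² / ((2z+3)(2z+4)).
C-gain : ∀ {n g} → g ≤ n C 2 → ∀ z → 64 * suc z ≤ n → g * ((2 * n) C z) ≤ n C (2 * suc z)
C-gain {n} {g} g≤ zero    _  rewrite nC0≡1 (2 * n) | *-identityʳ g = g≤
C-gain {n} {g} g≤ (suc z) h  = subst (λ l → g * a′ ≤ n C l) (idx z)
  (*-cancelˡ-≤ (n * suc z) {{m*n≢0 n (suc z) {{>-nonZero (≤-trans (s≤s z≤n) h)}}}} (begin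
  n * suc z * (g * a′)
    ≡⟨ e₁ n (suc z) g a′ ⟩
  n * g * (suc z * a′)
    ≤⟨ *-monoʳ-≤ (n * g) (≤-trans (m≤m+n _ (z * a)) (≤-reflexive (C-absorption (2 * n) z))) ⟩
  n * g * (2 * n * a)
    ≡⟨ e₂ n g a ⟩
  2 * n * (n * (g * a))
    ≤⟨ *-monoʳ-≤ (2 * n) (*-monoʳ-≤ n (C-gain g≤ z (≤-trans (*-monoʳ-≤ 64 (n≤1+n (suc z))) h))) ⟩
  2 * n * (n * (n C k))
    ≤⟨ *-monoʳ-≤ (2 * n) (C-half {n} {k} (≤-trans (*-monoʳ-≤ 2 (n≤1+n k)) 2[1+k]≤n)) ⟩
  2 * n * (2 * (suc k * (n C suc k)))
    ≡⟨ e₃ n (suc k) (n C suc k) ⟩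
  4 * suc k * (n * (n C suc k))
    ≤⟨ *-monoʳ-≤ (4 * suc k) (C-half {n} {suc k} 2[1+k]≤n) ⟩
  4 * suc k * (2 * (suc (suc k) * b))
    -- The constant 64 arises here: `suc k` = 2z + 3 is at most 4(z+1) and `suc (suc k)` = 2(z+2),
    -- so the numerical factors are 4 · 4 · 2 · 2.
    ≤⟨ *-monoˡ-≤ (2 * (suc (suc k) * b))
         (*-monoʳ-≤ 4 (≤-trans (m≤m+n (suc k) (1 + 2 * z)) (≤-reflexive (e₅ z)))) ⟩
  4 * (4 * suc z) * (2 * (suc (suc k) * b))
    ≡⟨ e₄ z b ⟩
  64 * suc (suc z) * (suc z * b)
    ≤⟨ *-monoˡ-≤ (suc z * b) h ⟩
  n * (suc z * b)
    ≡⟨ *-assoc n (suc z) b ⟨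
  n * suc z * b ∎))
  where
  open ≤-Reasoning
  k  = 2 * suc z
  a  = (2 * n) C z
  a′ = (2 * n) C suc z
  b  = n C suc (suc k)
  idx : ∀ z → suc (suc (2 * suc z)) ≡ 2 * suc (suc z)
  idx = solve-∀
  e₁ : ∀ n z g a → n * z * (g * a) ≡ n * g * (z * a)
  e₁ = solve-∀
  e₂ : ∀ n g a → n * g * (2 * n * a) ≡ 2 * n * (n * (g * a))
  e₂ = solve-∀
  e₃ : ∀ n k a → 2 * n * (2 * (k * a)) ≡ 4 * k * (n * a)
  e₃ = solve-∀
  e₄ : ∀ z b → 4 * (4 * suc z) * (2 * (suc (suc (2 * suc z)) * b)) ≡ 64 * suc (suc z) * (suc z * b)
  e₄ = solve-∀
  e₅ : ∀ z → suc (2 * suc z) + (1 + 2 * z) ≡ 4 * suc z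
  e₅ = solve-∀
  e₆ : ∀ z → 2 * suc (2 * suc z) + 2 ≡ 4 * suc (suc z)
  e₆ = solve-∀
  2[1+k]≤n : 2 * suc k ≤ n
  2[1+k]≤n = ≤-trans (m≤m+n _ 2) (≤-trans (≤-reflexive (e₆ z))
    (≤-trans (*-monoˡ-≤ (suc (suc z)) (m≤m+n 4 60)) h))

-- C(n,2) is quadratic in n and the left side linear. The factor `suc (2 * n)` will pay for the 2n +
-- 1 possible flip counts, and `suc k` remains as the gain in probability.
C2-gain : ∀ {n} k → 4 * k + 6 ≤ n → suc k * suc (2 * n) ≤ n C 2
C2-gain {n} k h = *-cancelˡ-≤ 2 (+-cancelʳ-≤ (1 * (n C 1)) _ _ (begin
  2 * (suc k * suc (2 * n)) + 1 * (n C 1)     ≡⟨ cong (λ c → 2 * (suc k * suc (2 * n)) + 1 * c) (nC1≡n n) ⟩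
  2 * (suc k * suc (2 * n)) + 1 * n           ≡⟨ e₁ k n ⟩
  (4 * k + 5) * n + (2 * k + 2)
    ≤⟨ +-monoʳ-≤ ((4 * k + 5) * n) (≤-trans (m≤m+n (2 * k + 2) (2 * k + 4))
         (≤-trans (≤-reflexive (e₂ k)) h)) ⟩
  (4 * k + 5) * n + n                         ≡⟨ e₃ k n ⟩
  (4 * k + 6) * n                             ≤⟨ *-monoˡ-≤ n h ⟩
  n * n                                       ≡⟨ cong (n *_) (nC1≡n n) ⟨
  n * (n C 1)                                 ≡⟨ C-absorption n 1 ⟨
  2 * (n C 2) + 1 * (n C 1)                   ∎))
  where
  open ≤-Reasoning
  e₁ : ∀ k n → 2 * (suc k * suc (2 * n)) + 1 * n ≡ (4 * k + 5) * n + (2 * k + 2)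
  e₁ = solve-∀
  e₂ : ∀ k → (2 * k + 2) + (2 * k + 4) ≡ 4 * k + 6
  e₂ = solve-∀
  e₃ : ∀ k n → (4 * k + 5) * n + n ≡ (4 * k + 6) * n
  e₃ = solve-∀

-- Sums over `Fin n`, and colourings counted by their flips.

⟦⟧≤1 : ∀ b → ⟦ b ⟧ ≤ 1
⟦⟧≤1 true  = ≤-refl
⟦⟧≤1 false = z≤n

term≤∑-allFin : (i : Fin n) (f : Fin n → ℕ) → f i ≤ ∑ (allFin n) f
term≤∑-allFin F.zero    f = ≤-trans (m≤m+n _ _) (≤-reflexive (sym (∑-allFin-suc f)))
term≤∑-allFin (F.suc i) f = ≤-trans (term≤∑-allFin i (f ∘ F.suc))
  (≤-trans (m≤n+m _ (f F.zero)) (≤-reflexive (sym (∑-allFin-suc f))))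

∑-allFin-const : ∀ n c → ∑ (allFin n) (λ _ → c) ≡ n * c
∑-allFin-const zero    c = refl
∑-allFin-const (suc n) c = trans (∑-allFin-suc {n} (λ _ → c)) (cong (c +_) (∑-allFin-const n c))

-- The head of a subset of size suc m is read as the entry of index m, so that the parent ⌊ m /2⌋
-- of a node always lies in the tail.
at : Subset m → ℕ → Bool
at []              i = false
at {suc m} (x ∷ X) i = if m ≡ᵇ i then x else at X i

fromColour : ∀ m → (ℕ → Bool) → Subset m
fromColour zero    c = []
fromColour (suc m) c = c m ∷ fromColour m c

at-fromColour : ∀ {m i} c → i < m → at (fromColour m c) i ≡ c i
at-fromColour {suc m} {i} c i<1+m with m ≟ i
... | yes refl rewrite ≡ᵇ-refl m = refl
... | no  m≢i  rewrite ≢⇒≡ᵇ-false m≢i = at-fromColour c (≤∧≢⇒< (s≤s⁻¹ i<1+m) (m≢i ∘ sym))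

-- Entry 0 is compared with the default `false` of `at` on the empty vector, and entry 1 with entry
-- 0. Every entry thus contributes one bit, and these bits determine the colouring.
flips : Subset m → ℕ
flips []              = 0
flips {suc m} (x ∷ X) = ⟦ x xor at X ⌊ m /2⌋ ⟧ + flips X

flips≤ : (X : Subset m) → flips X ≤ m
flips≤ []      = z≤n
flips≤ {suc m} (x ∷ X) = +-mono-≤ (⟦⟧≤1 (x xor at X ⌊ m /2⌋)) (flips≤ X)

flips-fromColour : ∀ m c →
  flips (fromColour m c) ≡ ∑ (downFrom m) (λ x → ⟦ c x xor at (fromColour x c) ⌊ x /2⌋ ⟧)
flips-fromColour zero    c = refl
flips-fromColour (suc m) c = cong (⟦ c m xor at (fromColour m c) ⌊ m /2⌋ ⟧ +_) (flips-fromColour m c)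

-- Exactly one of the two extensions of X adds a flip, which is Pascal's rule.
flips-distribution : ∀ m z → ∑ (allSubsets m) (λ X → ⟦ flips X ≡ᵇ z ⟧) ≡ m C z
flips-distribution zero    zero    = sym (nC0≡1 0)
flips-distribution zero    (suc z) = sym (k>n⇒nCk≡0 {0} {suc z} z<s)
flips-distribution (suc m) z = trans (∑-allSubsets-suc m _)
  (trans (∑-cong (allSubsets m) (λ X → extend (at X ⌊ m /2⌋) (flips X)))
    (trans (∑-+ (allSubsets m) _ _) (pascal z)))
  where
  extend : ∀ b f → ⟦ ⟦ true xor b ⟧ + f ≡ᵇ z ⟧ + ⟦ ⟦ false xor b ⟧ + f ≡ᵇ z ⟧
                 ≡ ⟦ suc f ≡ᵇ z ⟧ + ⟦ f ≡ᵇ z ⟧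
  extend true  f = +-comm ⟦ f ≡ᵇ z ⟧ _
  extend false f = refl
  pascal : ∀ z → ∑ (allSubsets m) (λ X → ⟦ suc (flips X) ≡ᵇ z ⟧)
               + ∑ (allSubsets m) (λ X → ⟦ flips X ≡ᵇ z ⟧) ≡ suc m C z
  pascal zero    = trans (cong₂ _+_ (∑-zero (allSubsets m) (λ _ → refl)) (flips-distribution m 0))
                         (trans (nC0≡1 m) (sym (nC0≡1 (suc m))))
  pascal (suc z) = trans (cong₂ _+_ (flips-distribution m z) (flips-distribution m (suc z)))
                         (nCk+nC[k+1]≡[n+1]C[k+1] m z)

-- Group the colourings by their number z of flips. A level has C(m,z) members, each with `g * w X`
-- at most M / C(m,z), so each of the m + 1 levels contributes at most M.
flips-weighted-sum : ∀ g {M} (w : Subset m → ℕ) →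
  (∀ X → g * w X * (m C flips X) ≤ M) → g * ∑ (allSubsets m) w ≤ suc m * M
flips-weighted-sum {m} g {M} w bound = begin
  g * ∑ Xs w                                                  ≤⟨ *-monoʳ-≤ g (∑-mono Xs spread) ⟩
  g * ∑ Xs (λ X → ∑ zs (λ z → ⟦ flips X ≡ᵇ z ⟧ * w X))       ≡⟨ cong (g *_) (∑-swap Xs zs _) ⟩
  g * ∑ zs (λ z → level z)                                    ≡⟨ ∑-*ˡ zs g level ⟨
  ∑ zs (λ z → g * level z)                                    ≤⟨ ∑-downFrom-mono (suc m) level≤ ⟩
  ∑ zs (λ _ → M)                                              ≡⟨ ∑-downFrom-const (suc m) M ⟩
  suc m * M                                                   ∎
  where
  open ≤-Reasoning
  Xs = allSubsets m
  zs = downFrom (suc m)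
  level : ℕ → ℕ
  level z = ∑ Xs (λ X → ⟦ flips X ≡ᵇ z ⟧ * w X)
  spread : ∀ X → w X ≤ ∑ zs (λ z → ⟦ flips X ≡ᵇ z ⟧ * w X)
  spread X = ≤-trans
    (≤-reflexive (sym (trans (cong (λ b → ⟦ b ⟧ * w X) (≡ᵇ-refl (flips X))) (*-identityˡ (w X)))))
    (term≤∑-downFrom (λ z → ⟦ flips X ≡ᵇ z ⟧ * w X) (s≤s (flips≤ X)))
  rearrange : ∀ c g i w → c * (g * (i * w)) ≡ i * (g * w * c)
  rearrange = solve-∀
  termwise : ∀ z X → (m C z) * (g * (⟦ flips X ≡ᵇ z ⟧ * w X)) ≤ ⟦ flips X ≡ᵇ z ⟧ * M
  termwise z X rewrite rearrange (m C z) g ⟦ flips X ≡ᵇ z ⟧ (w X) with flips X ≡ᵇ z in eq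
  ... | false = z≤n
  ... | true  rewrite sym (≡ᵇ-true (flips X) z eq) = *-monoʳ-≤ 1 (bound X)
  level≤ : ∀ z → z < suc m → g * level z ≤ M
  -- The division by `m C z` is replaced by a cancellation; z ≤ m makes this coefficient nonzero.
  level≤ z z<1+m = *-cancelˡ-≤ (m C z) {{C-nonZero (s≤s⁻¹ z<1+m)}} (begin
    (m C z) * (g * level z)
      ≡⟨ cong ((m C z) *_) (∑-*ˡ Xs g _) ⟨
    (m C z) * ∑ Xs (λ X → g * (⟦ flips X ≡ᵇ z ⟧ * w X))
      ≡⟨ ∑-*ˡ Xs (m C z) _ ⟨
    ∑ Xs (λ X → (m C z) * (g * (⟦ flips X ≡ᵇ z ⟧ * w X)))
      ≤⟨ ∑-mono Xs (termwise z) ⟩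
    ∑ Xs (λ X → ⟦ flips X ≡ᵇ z ⟧ * M)
      ≡⟨ ∑-*ʳ Xs M _ ⟩
    ∑ Xs (λ X → ⟦ flips X ≡ᵇ z ⟧) * M
      ≡⟨ cong (_* M) (flips-distribution m z) ⟩
    (m C z) * M ∎)

-- Counting injections that respect a colouring.

infixl 6 _without_

_without_ : (Fin n → Bool) → Fin n → (Fin n → Bool)
(p without x) y = p y ∧ not (x == y)

size : (Fin n → Bool) → ℕ
size {n} p = ∑ (allFin n) (⟦_⟧ ∘ p)

size-without : (p : Fin n → Bool) (x : Fin n) → ⟦ p x ⟧ + size (p without x) ≡ size p
size-without {suc n} p F.zero = trans
  (cong (⟦ p F.zero ⟧ +_) (trans (∑-allFin-suc (⟦_⟧ ∘ (p without F.zero))) (cong₂ _+_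
    (p∧false (p F.zero)) (∑-cong (allFin n) (λ y → cong ⟦_⟧ (Bool.∧-identityʳ (p (F.suc y))))))))
  (sym (∑-allFin-suc (⟦_⟧ ∘ p)))
  where
  p∧false : ∀ b → ⟦ b ∧ false ⟧ ≡ 0
  p∧false true  = refl
  p∧false false = refl
size-without {suc n} p (F.suc x) = begin
  ⟦ p (F.suc x) ⟧ + size (p without F.suc x)
    ≡⟨ cong (⟦ p (F.suc x) ⟧ +_) (∑-allFin-suc (⟦_⟧ ∘ (p without F.suc x))) ⟩
  ⟦ p (F.suc x) ⟧ + (⟦ p F.zero ∧ true ⟧ + size (p ∘ F.suc without x))
    ≡⟨ cong (λ b → ⟦ p (F.suc x) ⟧ + (⟦ b ⟧ + size (p ∘ F.suc without x))) (Bool.∧-identityʳ (p F.zero)) ⟩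
  ⟦ p (F.suc x) ⟧ + (⟦ p F.zero ⟧ + size (p ∘ F.suc without x))
    ≡⟨ exchange ⟦ p (F.suc x) ⟧ ⟦ p F.zero ⟧ _ ⟩
  ⟦ p F.zero ⟧ + (⟦ p (F.suc x) ⟧ + size (p ∘ F.suc without x))
    ≡⟨ cong (⟦ p F.zero ⟧ +_) (size-without (p ∘ F.suc) x) ⟩
  ⟦ p F.zero ⟧ + size (p ∘ F.suc)
    ≡⟨ ∑-allFin-suc (⟦_⟧ ∘ p) ⟨
  size p ∎
  where
  open ≡-Reasoning
  exchange : ∀ a b c → a + (b + c) ≡ b + (a + c)
  exchange = solve-∀

size-without-< : ∀ (p : Fin n → Bool) x {k} → p x ≡ true → size p ≤ suc k → size (p without x) ≤ k
size-without-< p x px size≤ = s≤s⁻¹ (subst (λ b → ⟦ b ⟧ + size (p without x) ≤ _) px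
  (≤-trans (≤-reflexive (size-without p x)) size≤))

size-without-≤ : ∀ (p : Fin n → Bool) x {k} → size p ≤ k → size (p without x) ≤ k
size-without-≤ p x size≤ = ≤-trans (m+n≤o⇒n≤o ⟦ p x ⟧ (≤-reflexive (size-without p x))) size≤

_agrees_ : Bool → Bool → Bool
a agrees b = not (a xor b)

agrees-refl : ∀ a → a agrees a ≡ true
agrees-refl true  = refl
agrees-refl false = refl

count : Bool → Vec Bool m → ℕ
count c []      = 0
count c (a ∷ A) = ⟦ c agrees a ⟧ + count c A

count-total : (A : Vec Bool m) → count true A + count false A ≡ m
count-total []          = refl
count-total (true ∷ A)  = cong suc (count-total A)
count-total (false ∷ A) = trans (+-suc _ _) (cong suc (count-total A))

-- v is injective and sends each position i into the class p (A i).
matches : Vec Bool m → Vec (Fin n) m → (Bool → Fin n → Bool) → Bool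
matches []      []      p = true
matches (a ∷ A) (x ∷ v) p = p a x ∧ matches A v (λ c → p c without x)

matches-intro : (A : Vec Bool m) (v : Vec (Fin n) m) (p : Bool → Fin n → Bool) →
  (∀ i → p (lookup A i) (lookup v i) ≡ true) →
  (∀ i j → lookup v i ≡ lookup v j → i ≡ j) → matches A v p ≡ true
matches-intro []      []      p coloured inj = refl
matches-intro (a ∷ A) (x ∷ v) p coloured inj = cong₂ _∧_ (coloured F.zero)
  (matches-intro A v _
    (λ i → cong₂ _∧_ (coloured (F.suc i))
      (cong not (≢⇒≡ᵇ-false λ eq → F.0≢1+n (inj F.zero (F.suc i) (F.toℕ-injective eq)))))
    (λ i j eq → F.suc-injective (inj (F.suc i) (F.suc j) eq)))

-- The positions of colour `c` receive distinct values in `p c`: removing the head value from the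
-- class pays for the head position.
matches⇒count≤size : (A : Vec Bool m) (v : Vec (Fin n) m) (p : Bool → Fin n → Bool) →
  matches A v p ≡ true → ∀ c → count c A ≤ size (p c)
matches⇒count≤size []      []      p eq c = z≤n
matches⇒count≤size (a ∷ A) (x ∷ v) p eq c with p a x in pax
... | true = ≤-trans (+-mono-≤ (agree≤ c a pax) (matches⇒count≤size A v _ eq c))
                     (≤-reflexive (size-without (p c) x))
  where
  agree≤ : ∀ c a → p a x ≡ true → ⟦ c agrees a ⟧ ≤ ⟦ p c x ⟧
  agree≤ true  true  eq rewrite eq = ≤-refl
  agree≤ false false eq rewrite eq = ≤-refl
  agree≤ true  false eq = z≤n
  agree≤ false true  eq = z≤n

-- The head value is chosen first, and each choice in `p a` has at most `k` completions.
∑-matches-step : ∀ {k} (A : Vec Bool m) (p : Bool → Fin n → Bool) (a : Bool) →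
  (∀ x → p a x ≡ true → ∑ (allVecs m n) (λ v → ⟦ matches A v (λ c → p c without x) ⟧) ≤ k) →
  ∑ (allVecs (suc m) n) (λ v → ⟦ matches (a ∷ A) v p ⟧) ≤ size (p a) * k
∑-matches-step {m} {n} {k} A p a bound = begin
  ∑ (allVecs (suc m) n) (λ v → ⟦ matches (a ∷ A) v p ⟧)   ≡⟨ ∑-allVecs-suc m n _ ⟩
  ∑ vs (λ v → ∑ (allFin n) (λ x → f x v))                  ≡⟨ ∑-swap vs (allFin n) _ ⟩
  ∑ (allFin n) (λ x → ∑ vs (f x))                          ≤⟨ ∑-mono (allFin n) per-x ⟩
  ∑ (allFin n) (λ x → ⟦ p a x ⟧ * k)                       ≡⟨ ∑-*ʳ (allFin n) k _ ⟩
  size (p a) * k                                           ∎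
  where
  open ≤-Reasoning
  vs = allVecs m n
  f : Fin n → Vec (Fin n) m → ℕ
  f x v = ⟦ p a x ∧ matches A v (λ c → p c without x) ⟧
  per-x : ∀ x → ∑ vs (f x) ≤ ⟦ p a x ⟧ * k
  per-x x with p a x in pax
  ... | true  = ≤-trans (bound x pax) (≤-reflexive (sym (*-identityˡ k)))
  ... | false = ≤-reflexive (∑-zero vs (λ _ → refl))

-- Choosing a head value of its colour lowers both the count and the size of that class by one,
-- while the other class can only shrink. The hypothesis therefore survives, and the numbers of
-- choices multiply to the two factorials.
∑-matches≤ : (A : Vec Bool m) (p : Bool → Fin n → Bool) → (∀ c → size (p c) ≤ count c A) →
  ∑ (allVecs m n) (λ v → ⟦ matches A v p ⟧) ≤ count true A ! * count false A !
∑-matches≤ []          p size≤ = ≤-refl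
∑-matches≤ (true ∷ A)  p size≤ = ≤-trans
  (∑-matches-step A p true (λ x pax → ∑-matches≤ A _ λ where
    true  → size-without-< (p true) x pax (size≤ true)
    false → size-without-≤ (p false) x (size≤ false)))
  (≤-trans (*-monoˡ-≤ (count true A ! * count false A !) (size≤ true))
           (≤-reflexive (sym (*-assoc (suc (count true A)) (count true A !) _))))
∑-matches≤ (false ∷ A) p size≤ = ≤-trans
  (∑-matches-step A p false (λ x pax → ∑-matches≤ A _ λ where
    false → size-without-< (p false) x pax (size≤ false)
    true  → size-without-≤ (p true) x (size≤ true)))
  (≤-trans (*-monoˡ-≤ (count true A ! * count false A !) (size≤ false))
           (≤-reflexive (exchange (suc (count false A)) (count true A !) (count false A !))))
  where
  exchange : ∀ a b c → a * (b * c) ≡ b * (a * c)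
  exchange = solve-∀

complement< : ∀ {a b c d} → a + b ≡ c + d → c < a → b < d
complement< {a} {b} {c} {d} eq c<a = ≰⇒> λ d≤b → <⇒≢ (+-mono-<-≤ c<a d≤b) (sym eq)

-- If some class of p had the wrong size, no v would match at all.
∑-matches-bound : (A : Vec Bool m) (p : Bool → Fin n → Bool) → size (p true) + size (p false) ≡ m →
  ∑ (allVecs m n) (λ v → ⟦ matches A v p ⟧) ≤ count true A ! * count false A !
∑-matches-bound {m} {n} A p total = by-size
  where
  K = count true A ! * count false A !
  unmatched : ∀ c → size (p c) < count c A → ∑ (allVecs m n) (λ v → ⟦ matches A v p ⟧) ≤ K
  unmatched c size< = ≤-trans (≤-reflexive (∑-zero (allVecs m n) λ v →
    cong ⟦_⟧ (¬-not λ eq → <⇒≱ size< (matches⇒count≤size A v p eq c)))) z≤n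
  total′ : size (p true) + size (p false) ≡ count true A + count false A
  total′ = trans total (sym (count-total A))
  by-size : ∑ (allVecs m n) (λ v → ⟦ matches A v p ⟧) ≤ K
  by-size with size (p true) ≤? count true A | size (p false) ≤? count false A
  ... | no t≰  | _      = unmatched false (complement< total′ (≰⇒> t≰))
  ... | yes _  | no f≰  = unmatched true (complement< (trans (+-comm (size (p false)) _)
                            (trans total′ (+-comm (count true A) _))) (≰⇒> f≰))
  ... | yes t≤ | yes f≤ = ∑-matches≤ A p λ where
    true  → t≤
    false → f≤

-- Boolean quantifiers, cardinalities and bijections.

any-intro : ∀ (p : A → Bool) {x xs} → x ∈ xs → p x ≡ true → any p xs ≡ true
any-intro p (here refl) px rewrite px = refl
any-intro p {xs = y ∷ _} (there x∈) px with p y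
... | true  = refl
... | false = any-intro p x∈ px

any-elim : ∀ (p : A → Bool) xs → any p xs ≡ true → ∃[ x ] p x ≡ true
any-elim p (x ∷ xs) eq with p x in px
... | true  = x , px
... | false = any-elim p xs eq

all-elim : ∀ (p : A → Bool) {x xs} → all p xs ≡ true → x ∈ xs → p x ≡ true
all-elim p {xs = y ∷ _} eq x∈ with p y in py
all-elim p eq (here refl) | true = py
all-elim p eq (there x∈)  | true = all-elim p eq x∈

all-counterexample : ∀ (p : A → Bool) xs → all p xs ≡ false → ∃[ x ] p x ≡ false
all-counterexample p (x ∷ xs) eq with p x in px
... | true  = all-counterexample p xs eq
... | false = x , px

∣∣≡size : (S : Subset n) → ∣ S ∣ ≡ size (lookup S)
∣∣≡size []          = refl
∣∣≡size {suc n} (true ∷ S)  = trans (cong suc (∣∣≡size S))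
  (sym (∑-allFin-suc {n} (⟦_⟧ ∘ lookup (true ∷ S))))
∣∣≡size {suc n} (false ∷ S) = trans (∣∣≡size S)
  (sym (∑-allFin-suc {n} (⟦_⟧ ∘ lookup (false ∷ S))))

∣∣≡count : (S : Subset n) → ∣ S ∣ ≡ count true S
∣∣≡count []          = refl
∣∣≡count (true ∷ S)  = cong suc (∣∣≡count S)
∣∣≡count (false ∷ S) = ∣∣≡count S

-- Pigeonhole: if `y` were missed, punching it out would inject `Fin (suc n)` into `Fin n`.
injective⇒surjective : (f : Fin n → Fin n) → (∀ i j → f i ≡ f j → i ≡ j) → ∀ y → ∃[ x ] f x ≡ y
injective⇒surjective {suc n} f inj y with F.any? (λ x → f x F.≟ y)
... | yes found = found
... | no  ¬found = contradiction
  (λ {i} {j} eq → inj i j (F.punchOut-injective (missed i) (missed j) eq))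
  (F.<⇒notInjective {f = λ x → F.punchOut (missed x)} (n<1+n n))
  where
  missed : ∀ x → y ≢ f x
  missed x eq = ¬found (x , sym eq)

bijection-injective : (Π : Map n) → isBijection Π ≡ true → ∀ i j → lookup Π i ≡ lookup Π j → i ≡ j
bijection-injective Π bij i j eq = F.toℕ-injective (≡ᵇ-true (toℕ i) (toℕ j)
  (left (i == j) Πi==Πj (all-elim (λ j → (i == j) ∨ not (lookup Π i == lookup Π j))
    (all-elim _ bij (∈-allFin i)) (∈-allFin j))))
  where
  Πi==Πj : (lookup Π i == lookup Π j) ≡ true
  Πi==Πj = subst (λ x → (lookup Π i == x) ≡ true) eq (≡ᵇ-refl (toℕ (lookup Π i)))
  left : ∀ a {b} → b ≡ true → a ∨ not b ≡ true → a ≡ true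
  left true  _    _  = refl
  left false refl ()

-- The colouring induced by a vertex set, and its boundary.

module Contraction {n} (Π : Map n)
  (Π-injective : ∀ i j → lookup Π i ≡ lookup Π j → i ≡ j) (S : Subset n) where

  D : Fin n → Bool
  D = lookup (boundary Π S)

  slot : Fin n → ℕ
  slot j = toℕ (lookup Π j)

  -- Ownership refers to slots rather than tree nodes: the two root copies are the separate slots 0
  -- and 1, so each x < 2n has exactly one owner.
  Owns : Fin n → ℕ → Set
  Owns j x = (n + toℕ j ≡ x) ⊎ (slot j ≡ x)

  owns-unique : ∀ {i j x} → Owns i x → Owns j x → i ≡ j
  owns-unique (inj₁ p) (inj₁ q) = F.toℕ-injective (+-cancelˡ-≡ n _ _ (trans p (sym q)))
  owns-unique {i} {j} (inj₁ p) (inj₂ q) =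
    contradiction (trans q (sym p)) (<⇒≢ (≤-trans (F.toℕ<n (lookup Π j)) (m≤m+n n (toℕ i))))
  owns-unique {i} {j} (inj₂ p) (inj₁ q) =
    contradiction (trans p (sym q)) (<⇒≢ (≤-trans (F.toℕ<n (lookup Π i)) (m≤m+n n (toℕ j))))
  owns-unique (inj₂ p) (inj₂ q) = Π-injective _ _ (F.toℕ-injective (trans p (sym q)))

  owner : ∀ x → x < 2 * n → ∃[ j ] Owns j x
  owner x x<2n with x <? n
  ... | yes x<n = let j , Πj≡ = injective⇒surjective (lookup Π) Π-injective (F.fromℕ< x<n)
                  in j , inj₂ (trans (cong toℕ Πj≡) (F.toℕ-fromℕ< x<n))
  ... | no  x≮n = F.fromℕ< x∸n<n ,
                  inj₁ (trans (cong (n +_) (F.toℕ-fromℕ< x∸n<n)) (m+[n∸m]≡n (≮⇒≥ x≮n)))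
    where
    x∸n<n : x ∸ n < n
    x∸n<n = +-cancelˡ-< n _ _ (subst₂ _<_ (sym (m+[n∸m]≡n (≮⇒≥ x≮n))) (cong (n +_) (+-identityʳ n)) x<2n)

  owns? : ℕ → Fin n → Bool
  owns? x i = (n + toℕ i ≡ᵇ x) ∨ (slot i ≡ᵇ x)

  owns?-sound : ∀ x i → owns? x i ≡ true → Owns i x
  owns?-sound x i eq with n + toℕ i ≡ᵇ x in eq₁
  ... | true  = inj₁ (≡ᵇ-true _ x eq₁)
  ... | false = inj₂ (≡ᵇ-true _ x eq)

  owns?-complete : ∀ x i → Owns i x → owns? x i ≡ true
  owns?-complete x i (inj₁ refl) rewrite ≡ᵇ-refl (n + toℕ i) = refl
  owns?-complete x i (inj₂ refl) rewrite ≡ᵇ-refl (slot i) with n + toℕ i ≡ᵇ slot i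
  ... | true  = refl
  ... | false = refl

  colour : ℕ → Bool
  colour x = any (λ i → lookup S i ∧ owns? x i) (allFin n)

  colour-owner : ∀ {j x} → Owns j x → colour x ≡ lookup S j
  colour-owner {j} {x} o with lookup S j in Sj
  ... | true  = any-intro _ (∈-allFin j) (cong₂ _∧_ Sj (owns?-complete x j o))
  ... | false = ¬-not λ eq → absurd (any-elim (λ i → lookup S i ∧ owns? x i) (allFin n) eq)
    where
    absurd : ¬ (∃[ i ] lookup S i ∧ owns? x i ≡ true)
    absurd (i , eq) with lookup S i in Si
    ... | true with owns-unique {i} {j} {x} (owns?-sound x i eq) o
    ...   | refl = contradiction (trans (sym Si) Sj) λ ()

  -- A positive slot number is itself the tree node. Slot 0 stands for node 1 instead, hence the
  -- bound on `x`.
  owned∈pair : ∀ {i x} → 1 ≤ x → Owns i x → x ∈ pairNodes Π i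
  owned∈pair 1≤x (inj₁ refl) = here refl
  owned∈pair {i} 1≤x (inj₂ refl) with slot i | 1≤x
  ... | suc x | _ = there (here refl)

  boundary-intro : ∀ {i j u v} → Owns i u → Owns j v → 1 ≤ u → 1 ≤ v → treeAdj u v ≡ true →
    lookup S i ≡ true → lookup S j ≡ false → D j ≡ true
  boundary-intro {i} {j} {u} {v} oi oj 1≤u 1≤v adj Si Sj = trans (lookup∘tabulate _ j)
    (cong₂ _∧_ (cong not Sj) (any-intro (λ i → lookup S i ∧ gAdj Π i j) (∈-allFin i) (cong₂ _∧_ Si
      (cong₂ _∧_ (cong not (≢⇒≡ᵇ-false i≢j))
        (any-intro (λ a → any (treeAdj a) (pairNodes Π j)) (owned∈pair 1≤u oi)
          (any-intro (treeAdj u) (owned∈pair 1≤v oj) adj))))))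
    where
    i≢j : toℕ i ≢ toℕ j
    i≢j eq with F.toℕ-injective eq
    ... | refl = contradiction (trans (sym Si) Sj) λ ()

  parent-adj : ∀ {x} → 2 ≤ x → isParent ⌊ x /2⌋ x ≡ true
  parent-adj {suc (suc x)} (s≤s (s≤s z≤n)) = ≡ᵇ-refl ⌊ x /2⌋

  half≥1 : ∀ {x} → 2 ≤ x → 1 ≤ ⌊ x /2⌋
  half≥1 {suc (suc x)} (s≤s (s≤s z≤n)) = s≤s z≤n

  -- The tree edge from `x` to its parent joins a pair in `S` to a pair outside `S`; the latter lies
  -- in the boundary.
  flip-owner : ∀ x → 2 ≤ x → x < 2 * n → colour x ≢ colour ⌊ x /2⌋ →
    ∃[ j ] D j ≡ true × (Owns j x ⊎ Owns j ⌊ x /2⌋)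
  flip-owner x 2≤x x<2n c≢ with owner x x<2n | owner ⌊ x /2⌋ (≤-<-trans (⌊n/2⌋≤n x) x<2n)
  ... | i , oi | j , oj rewrite colour-owner oi | colour-owner oj
    with lookup S i in Si | lookup S j in Sj
  ... | true  | true  = contradiction refl c≢
  ... | false | false = contradiction refl c≢
  ... | true  | false = j , boundary-intro oi oj (<⇒≤ 2≤x) (half≥1 2≤x)
                              (∨-trueʳ (isParent x ⌊ x /2⌋) (parent-adj 2≤x)) Si Sj , inj₂ oj
    where
    ∨-trueʳ : ∀ a {b} → b ≡ true → a ∨ b ≡ true
    ∨-trueʳ true  eq = refl
    ∨-trueʳ false eq = eq
  ... | false | true  = i , boundary-intro oj oi (half≥1 2≤x) (<⇒≤ 2≤x)
                              (cong (_∨ isParent x ⌊ x /2⌋) (parent-adj 2≤x)) Sj Si , inj₁ oi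

  -- The places where pair `j` can account for a flip: its leaf, its internal slot, and the two
  -- children of that slot.
  charge : Fin n → ℕ → ℕ
  charge j x = ⟦ n + toℕ j ≡ᵇ x ⟧ + (⟦ slot j ≡ᵇ x ⟧ + (⟦ 2 * slot j ≡ᵇ x ⟧ + ⟦ suc (2 * slot j) ≡ᵇ x ⟧))

  ⟦≡ᵇ⟧ : ∀ {a b} → a ≡ b → 1 ≤ ⟦ a ≡ᵇ b ⟧
  ⟦≡ᵇ⟧ {a} refl rewrite ≡ᵇ-refl a = ≤-refl

  double-half : ∀ x → (2 * ⌊ x /2⌋ ≡ x) ⊎ (suc (2 * ⌊ x /2⌋) ≡ x)
  double-half zero          = inj₁ refl
  double-half (suc zero)    = inj₂ refl
  double-half (suc (suc x)) rewrite +-suc ⌊ x /2⌋ (⌊ x /2⌋ + 0) with double-half x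
  ... | inj₁ eq = inj₁ (cong (λ y → suc (suc y)) eq)
  ... | inj₂ eq = inj₂ (cong (λ y → suc (suc y)) eq)

  charge≥1 : ∀ j x → x < 2 * n → Owns j x ⊎ Owns j ⌊ x /2⌋ → 1 ≤ charge j x
  charge≥1 j x _ (inj₁ (inj₁ eq)) = ≤-trans (⟦≡ᵇ⟧ eq) (m≤m+n _ _)
  charge≥1 j x _ (inj₁ (inj₂ eq)) = ≤-trans (≤-trans (⟦≡ᵇ⟧ eq) (m≤m+n _ _)) (m≤n+m _ ⟦ n + toℕ j ≡ᵇ x ⟧)
  -- A leaf is never the parent here: its children would be at least 2n.
  charge≥1 j x x<2n (inj₂ (inj₁ eq)) = contradiction
    (≤-trans (*-monoʳ-≤ 2 n≤half) (2half≤ (double-half x))) (<⇒≱ x<2n)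
    where
    n≤half : n ≤ ⌊ x /2⌋
    n≤half = ≤-trans (m≤m+n n (toℕ j)) (≤-reflexive eq)
    2half≤ : (2 * ⌊ x /2⌋ ≡ x) ⊎ (suc (2 * ⌊ x /2⌋) ≡ x) → 2 * ⌊ x /2⌋ ≤ x
    2half≤ (inj₁ e) = ≤-reflexive e
    2half≤ (inj₂ e) = <⇒≤ (≤-reflexive e)
  charge≥1 j x _ (inj₂ (inj₂ eq)) =
    ≤-trans (≤-trans (child (double-half x)) (m≤n+m _ ⟦ slot j ≡ᵇ x ⟧)) (m≤n+m _ ⟦ n + toℕ j ≡ᵇ x ⟧)
    where
    child : (2 * ⌊ x /2⌋ ≡ x) ⊎ (suc (2 * ⌊ x /2⌋) ≡ x) →
            1 ≤ ⟦ 2 * slot j ≡ᵇ x ⟧ + ⟦ suc (2 * slot j) ≡ᵇ x ⟧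
    child (inj₁ e) = ≤-trans (⟦≡ᵇ⟧ (trans (cong (2 *_) eq) e)) (m≤m+n _ _)
    child (inj₂ e) = ≤-trans (⟦≡ᵇ⟧ (trans (cong (λ y → suc (2 * y)) eq) e)) (m≤n+m _ _)

  charge-total : ∀ j m → ∑ (downFrom m) (charge j) ≤ 4
  charge-total j m = begin
    ∑ xs (charge j)
      ≡⟨ trans (∑-+ xs _ _) (cong (∑ xs (λ x → ⟦ n + toℕ j ≡ᵇ x ⟧) +_)
           (trans (∑-+ xs _ _) (cong (∑ xs (λ x → ⟦ slot j ≡ᵇ x ⟧) +_) (∑-+ xs _ _)))) ⟩
    _ ≤⟨ +-mono-≤ (∑-downFrom-≡ᵇ (n + toℕ j) m) (+-mono-≤ (∑-downFrom-≡ᵇ (slot j) m)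
           (+-mono-≤ (∑-downFrom-≡ᵇ (2 * slot j) m) (∑-downFrom-≡ᵇ (suc (2 * slot j)) m))) ⟩
    4 ∎
    where
    open ≤-Reasoning
    xs = downFrom m

  X : Subset (2 * n)
  X = fromColour (2 * n) colour

  xor-≢ : ∀ a b → 1 ≤ ⟦ a xor b ⟧ → a ≢ b
  xor-≢ true  false _ ()
  xor-≢ false true  _ ()

  -- Both 0 and 1 are copies of the root, with no tree edge to a parent, so their flips are paid by
  -- the two extra indicators. Any other flip is charged to the boundary pair from `flip-owner`.
  flip≤charges : ∀ x → x < 2 * n → ⟦ colour x xor at (fromColour x colour) ⌊ x /2⌋ ⟧ ≤
    (⟦ 0 ≡ᵇ x ⟧ + ⟦ 1 ≡ᵇ x ⟧) + ∑ (allFin n) (λ j → ⟦ D j ⟧ * charge j x)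
  flip≤charges zero          _ = ≤-trans (⟦⟧≤1 (colour 0 xor false)) (m≤m+n 1 _)
  flip≤charges (suc zero)    _ = ≤-trans (⟦⟧≤1 (colour 1 xor at (fromColour 1 colour) 0)) (m≤m+n 1 _)
  flip≤charges x@(suc (suc y)) x<2n
    rewrite at-fromColour {x} {⌊ x /2⌋} colour (⌊n/2⌋<n (suc y))
    with colour x xor colour ⌊ x /2⌋ in eq
  ... | false = z≤n
  ... | true with flip-owner x (s≤s (s≤s z≤n)) x<2n
                     (xor-≢ (colour x) (colour ⌊ x /2⌋) (≤-reflexive (cong ⟦_⟧ (sym eq))))
  ...   | j , Dj , o = ≤-trans
    (≤-trans (charge≥1 j x x<2n o) (≤-reflexive (trans (sym (*-identityˡ (charge j x)))
      (cong (λ b → ⟦ b ⟧ * charge j x) (sym Dj)))))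
    (term≤∑-allFin j (λ j → ⟦ D j ⟧ * charge j x))

  -- Double counting: after exchanging the sums over places and pairs, each boundary pair pays at
  -- most 4.
  flips≤boundary : flips X ≤ 2 + 4 * ∣ boundary Π S ∣
  flips≤boundary = begin
    flips X
      ≡⟨ flips-fromColour (2 * n) colour ⟩
    ∑ xs (λ x → ⟦ colour x xor at (fromColour x colour) ⌊ x /2⌋ ⟧)
      ≤⟨ ∑-downFrom-mono (2 * n) flip≤charges ⟩
    ∑ xs (λ x → (⟦ 0 ≡ᵇ x ⟧ + ⟦ 1 ≡ᵇ x ⟧) + ∑ (allFin n) (λ j → ⟦ D j ⟧ * charge j x))
      ≡⟨ trans (∑-+ xs _ _) (cong₂ _+_ (∑-+ xs _ _) (∑-swap xs (allFin n) _)) ⟩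
    (∑ xs (λ x → ⟦ 0 ≡ᵇ x ⟧) + ∑ xs (λ x → ⟦ 1 ≡ᵇ x ⟧))
      + ∑ (allFin n) (λ j → ∑ xs (λ x → ⟦ D j ⟧ * charge j x))
      ≤⟨ +-mono-≤ (+-mono-≤ (∑-downFrom-≡ᵇ 0 (2 * n)) (∑-downFrom-≡ᵇ 1 (2 * n)))
           (∑-mono (allFin n) (λ j → ≤-trans (≤-reflexive (∑-*ˡ xs ⟦ D j ⟧ (charge j)))
             (*-monoʳ-≤ ⟦ D j ⟧ (charge-total j (2 * n))))) ⟩
    2 + ∑ (allFin n) (λ j → ⟦ D j ⟧ * 4)
      ≡⟨ cong (2 +_) (trans (∑-*ʳ (allFin n) 4 (⟦_⟧ ∘ D))
           (trans (*-comm (size D) 4) (cong (4 *_) (sym (∣∣≡size (boundary Π S)))))) ⟩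
    2 + 4 * ∣ boundary Π S ∣ ∎
    where
    open ≤-Reasoning
    xs = downFrom (2 * n)

  -- Connectivity of the tree: with an empty boundary the colour of the root spreads to all nodes,
  -- so `S` is empty or everything, and the two hypotheses exclude both.
  boundary-nonempty : 0 < ∣ S ∣ → 2 * ∣ S ∣ ≤ n → 0 < ∣ boundary Π S ∣
  boundary-nonempty 0<s 2s≤n with ∣ boundary Π S ∣ in d≡
  ... | suc _ = s≤s z≤n
  ... | zero  = contradiction (∣S∣≡ (colour 1) refl) λ eq → impossible (colour 1) eq
    where
    D-false : ∀ j → D j ≢ true
    D-false j Dj = <⇒≢ (≤-trans (≤-reflexive (cong ⟦_⟧ (sym Dj))) (term≤∑-allFin j (⟦_⟧ ∘ D)))
                       (trans (sym d≡) (∣∣≡size (boundary Π S)))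
    constant : ∀ x → 1 ≤ x → x < 2 * n → colour x ≡ colour 1
    constant = <-rec _ go
      where
      go : ∀ x → (∀ {y} → y < x → 1 ≤ y → y < 2 * n → colour y ≡ colour 1) →
           1 ≤ x → x < 2 * n → colour x ≡ colour 1
      go (suc zero)        rec _ _    = refl
      go x@(suc (suc y))   rec _ x<2n with colour x Bool.≟ colour ⌊ x /2⌋
      ... | yes eq = trans eq (rec (⌊n/2⌋<n (suc y)) (s≤s z≤n) (≤-<-trans (⌊n/2⌋≤n x) x<2n))
      ... | no neq = let j , Dj , _ = flip-owner x (s≤s (s≤s z≤n)) x<2n neq
                     in contradiction Dj (D-false j)
    0<n : 0 < n
    0<n = ≤-trans 0<s (≤-trans (m≤m+n ∣ S ∣ _) 2s≤n)
    -- Membership of `j` is read off at its leaf, which lies in the range covered by `constant`.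
    S-constant : ∀ j → lookup S j ≡ colour 1
    S-constant j = trans (sym (colour-owner {j} (inj₁ refl))) (constant (n + toℕ j)
      (≤-trans 0<n (m≤m+n n _)) (+-monoʳ-< n (≤-trans (F.toℕ<n j) (m≤m+n n 0))))
    ∣S∣≡ : ∀ b → colour 1 ≡ b → ∣ S ∣ ≡ n * ⟦ b ⟧
    ∣S∣≡ b eq = trans (∣∣≡size S)
      (trans (∑-cong (allFin n) (λ j → cong ⟦_⟧ (trans (S-constant j) eq))) (∑-allFin-const n ⟦ b ⟧))
    impossible : ∀ b → ∣ S ∣ ≢ n * ⟦ b ⟧
    impossible false eq = <⇒≢ 0<s (sym (trans eq (*-zeroʳ n)))
    impossible true  eq = <⇒≱ (m<m+n n (≤-trans 0<n (m≤m+n n 0)))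
      (subst (λ s → 2 * s ≤ n) (trans eq (*-identityʳ n)) 2s≤n)

-- From a violated expansion bound to few flips.

T⇒≡true : ∀ {b} → T b → b ≡ true
T⇒≡true = Equivalence.to T-≡

≡true⇒T : ∀ {b} → b ≡ true → T b
≡true⇒T = Equivalence.from T-≡

violation : ∀ {n} s d → not (2 * s ≤ᵇ n) ∨ (s ≤ᵇ 480 * d) ≡ false → 2 * s ≤ n × 480 * d < s
violation {n} s d h with 2 * s ≤ᵇ n in eq₁ | s ≤ᵇ 480 * d in eq₂
... | true | false = ≤ᵇ⇒≤ (2 * s) n (≡true⇒T eq₁) ,
  ≰⇒> λ s≤ → contradiction (trans (sym (T⇒≡true (≤⇒≤ᵇ s≤))) eq₂) λ ()

-- Since d ≥ 1, z + 1 ≤ 3 + 4d ≤ 7d, and 68 is the largest integer with 7 · 68 ≤ 480. It exceeds the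
-- 64 that `C-gain` asks for.
few-flips : ∀ z d s → 1 ≤ d → z ≤ 2 + 4 * d → 480 * d < s → 68 * suc z < s
few-flips z d s 1≤d z≤ 480d<s = begin-strict
  68 * suc z              ≤⟨ *-monoʳ-≤ 68 (s≤s z≤) ⟩
  68 * (3 + 4 * d)        ≤⟨ *-monoʳ-≤ 68 (+-monoˡ-≤ (4 * d) (*-monoʳ-≤ 3 1≤d)) ⟩
  68 * (3 * d + 4 * d)    ≡⟨ cong (68 *_) (*-distribʳ-+ d 3 4) ⟨
  68 * (7 * d)            ≡⟨ *-assoc 68 7 d ⟨
  476 * d                 ≤⟨ *-monoˡ-≤ d (m≤m+n 476 4) ⟩
  480 * d                 <⟨ 480d<s ⟩
  s                       ∎
  where open ≤-Reasoning

-- The union bound over colourings.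

module Colouring (n : ℕ) where

  leaves : Subset (2 * n) → Vec Bool n
  leaves X = tabulate (λ i → at X (n + toℕ i))

  -- The internal slots of colour `c`: the values open to leaves of that colour.
  classes : Subset (2 * n) → Bool → Fin n → Bool
  classes X c j = c agrees at X (toℕ j)

  classes-total : (X : Subset (2 * n)) → size (classes X true) + size (classes X false) ≡ n
  classes-total X = begin
    size (classes X true) + size (classes X false)
      ≡⟨ ∑-+ (allFin n) (⟦_⟧ ∘ classes X true) (⟦_⟧ ∘ classes X false) ⟨
    ∑ (allFin n) (λ j → ⟦ classes X true j ⟧ + ⟦ classes X false j ⟧)
      ≡⟨ ∑-cong (allFin n) (λ j → one (at X (toℕ j))) ⟩
    ∑ (allFin n) (λ _ → 1)
      ≡⟨ trans (∑-allFin-const n 1) (*-identityʳ n) ⟩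
    n ∎
    where
    open ≡-Reasoning
    one : ∀ b → ⟦ true agrees b ⟧ + ⟦ false agrees b ⟧ ≡ 1
    one true  = refl
    one false = refl

  -- What a violating set leaves visible in its colouring alone, without reference to the bijection.
  admissible : Subset (2 * n) → Bool
  admissible X = (68 * suc (flips X) <ᵇ s) ∧ (2 * s ≤ᵇ n)
    where s = count true (leaves X)

  weight : Subset (2 * n) → ℕ
  weight X = ⟦ admissible X ⟧ * (count true (leaves X) ! * count false (leaves X) !)

  -- With z flips and s coloured leaves, `C-gain` and monotonicity up to the middle bound the gain
  -- times C(2n,z) by C(n,2(z+1)) ≤ C(n,s), and C(n,s) s! (n-s)! = n!.
  gain-weight : ∀ k → 4 * k + 6 ≤ n → (X : Subset (2 * n)) →
    suc k * suc (2 * n) * weight X * ((2 * n) C flips X) ≤ n !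
  gain-weight k n-large X with 68 * suc (flips X) <ᵇ count true (leaves X) in eq₁
    | 2 * count true (leaves X) ≤ᵇ n in eq₂
  ... | false | _     rewrite *-zeroʳ (suc k * suc (2 * n)) = z≤n
  ... | true  | false rewrite *-zeroʳ (suc k * suc (2 * n)) = z≤n
  ... | true  | true  = begin
    G * (1 * (s ! * f !)) * c        ≡⟨ rearrange G (s !) (f !) c ⟩
    G * c * (s ! * f !)              ≤⟨ *-monoˡ-≤ (s ! * f !) (C-gain (C2-gain k n-large) z 64z≤n) ⟩
    (n C (2 * suc z)) * (s ! * f !)  ≤⟨ *-monoˡ-≤ (s ! * f !) (C-mono (≤⇒≤′ 2z≤s) 2s≤n) ⟩
    (n C s) * (s ! * f !)            ≡⟨ cong (λ f → (n C s) * (s ! * f !)) f≡ ⟩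
    (n C s) * (s ! * (n ∸ s) !)      ≡⟨ C-factorial s≤n ⟩
    n !                              ∎
    where
    open ≤-Reasoning
    G = suc k * suc (2 * n)
    s = count true (leaves X)
    f = count false (leaves X)
    z = flips X
    c = (2 * n) C z
    rearrange : ∀ g a b c → g * (1 * (a * b)) * c ≡ g * c * (a * b)
    rearrange = solve-∀
    2s≤n : 2 * s ≤ n
    2s≤n = ≤ᵇ⇒≤ (2 * s) n (≡true⇒T eq₂)
    s≤n : s ≤ n
    s≤n = ≤-trans (m≤m+n s _) 2s≤n
    68z≤s : 68 * suc z ≤ s
    68z≤s = <⇒≤ (<ᵇ⇒< (68 * suc z) s (≡true⇒T eq₁))
    2z≤s : 2 * suc z ≤ s
    2z≤s = ≤-trans (*-monoˡ-≤ (suc z) (m≤m+n 2 66)) 68z≤s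
    64z≤n : 64 * suc z ≤ n
    64z≤n = ≤-trans (*-monoˡ-≤ (suc z) (m≤m+n 64 4)) (≤-trans 68z≤s s≤n)
    f≡ : f ≡ n ∸ s
    f≡ = trans (sym (m+n∸m≡n s f)) (cong (_∸ s) (count-total (leaves X)))

  isBad : Map n → Bool
  isBad Π = isBijection Π ∧ not (expansionAtLeast1/480 Π)

  bad-set : (Π : Map n) → expansionAtLeast1/480 Π ≡ false →
    ∃[ S ] (2 * ∣ S ∣ ≤ n × 480 * ∣ boundary Π S ∣ < ∣ S ∣)
  bad-set Π eq =
    let S , h = all-counterexample _ (allSubsets n) eq in S , violation ∣ S ∣ ∣ boundary Π S ∣ h

  -- The witness is the colouring induced by `S`. Its leaves recover `S`, and `Π` respects it
  -- because a leaf and its image have the same owner.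
  low-expansion⇒colouring : (Π : Map n) (S : Subset n) →
    (∀ i j → lookup Π i ≡ lookup Π j → i ≡ j) →
    2 * ∣ S ∣ ≤ n → 480 * ∣ boundary Π S ∣ < ∣ S ∣ →
    ∃[ X ] (admissible X ∧ matches (leaves X) Π (classes X) ≡ true)
  low-expansion⇒colouring Π S Π-injective 2s≤n 480d<s = X , cong₂ _∧_
    (cong₂ _∧_ (T⇒≡true (<⇒<ᵇ (subst (68 * suc (flips X) <_) (sym s≡) 68z<s)))
               (T⇒≡true (≤⇒≤ᵇ (subst (λ s → 2 * s ≤ n) (sym s≡) 2s≤n))))
    (matches-intro (leaves X) Π (classes X) coloured Π-injective)
    where
    open Contraction Π Π-injective S
    leaf-colour : ∀ i → lookup (leaves X) i ≡ lookup S i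
    leaf-colour i = trans (lookup∘tabulate _ i)
      (trans (at-fromColour colour (+-monoʳ-< n (≤-trans (F.toℕ<n i) (m≤m+n n 0))))
        (colour-owner (inj₁ refl)))
    leaves≡S : leaves X ≡ S
    leaves≡S = trans (sym (tabulate∘lookup (leaves X))) (trans (tabulate-cong leaf-colour) (tabulate∘lookup S))
    s≡ : count true (leaves X) ≡ ∣ S ∣
    s≡ = trans (cong (count true) leaves≡S) (sym (∣∣≡count S))
    coloured : ∀ i → classes X (lookup (leaves X) i) (lookup Π i) ≡ true
    coloured i = trans (cong₂ _agrees_ (leaf-colour i)
        (trans (at-fromColour colour (≤-trans (F.toℕ<n (lookup Π i)) (m≤m+n n _))) (colour-owner (inj₂ refl))))
      (agrees-refl (lookup S i))
    68z<s : 68 * suc (flips X) < ∣ S ∣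
    68z<s = few-flips (flips X) ∣ boundary Π S ∣ ∣ S ∣
      (boundary-nonempty (≤-trans (s≤s z≤n) 480d<s) 2s≤n) flips≤boundary 480d<s

  bad-colouring : (Π : Map n) → isBad Π ≡ true →
    ∃[ X ] (admissible X ∧ matches (leaves X) Π (classes X) ≡ true)
  bad-colouring Π eq =
    let bij , exp = ∧-elim (isBijection Π) (expansionAtLeast1/480 Π) eq
        S , 2s≤n , 480d<s = bad-set Π exp
    in low-expansion⇒colouring Π S (bijection-injective Π bij) 2s≤n 480d<s
    where
    ∧-elim : ∀ a b → a ∧ not b ≡ true → a ≡ true × b ≡ false
    ∧-elim true false _ = refl , refl

  -- Each bad map matches some admissible colouring. After exchanging the sums, the maps matching a
  -- fixed colouring are counted; `matches` already forces injectivity, so the sum may run over all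
  -- maps.
  badCount≤∑weight : badCount n ≤ ∑ (allSubsets (2 * n)) weight
  badCount≤∑weight = begin
    badCount n
      ≡⟨ length-filter≡∑ isBad (allVecs n n) ⟩
    ∑ Πs (⟦_⟧ ∘ isBad)
      ≤⟨ ∑-mono Πs bad≤ ⟩
    ∑ Πs (λ Π → ∑ Xs (λ X → ⟦ admissible X ⟧ * ⟦ matches (leaves X) Π (classes X) ⟧))
      ≡⟨ ∑-swap Πs Xs _ ⟩
    ∑ Xs (λ X → ∑ Πs (λ Π → ⟦ admissible X ⟧ * ⟦ matches (leaves X) Π (classes X) ⟧))
      ≤⟨ ∑-mono Xs (λ X → ≤-trans (≤-reflexive (∑-*ˡ Πs ⟦ admissible X ⟧ _))
           (*-monoʳ-≤ ⟦ admissible X ⟧ (∑-matches-bound (leaves X) (classes X) (classes-total X)))) ⟩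
    ∑ Xs weight ∎
    where
    open ≤-Reasoning
    Πs = allVecs n n
    Xs = allSubsets (2 * n)
    ⟦∧⟧ : ∀ a b → ⟦ a ∧ b ⟧ ≡ ⟦ a ⟧ * ⟦ b ⟧
    ⟦∧⟧ true  b = sym (+-identityʳ ⟦ b ⟧)
    ⟦∧⟧ false b = refl
    ⟦⟧≤ : ∀ b {m} → (b ≡ true → 1 ≤ m) → ⟦ b ⟧ ≤ m
    ⟦⟧≤ true  h = h refl
    ⟦⟧≤ false h = z≤n
    bad≤ : ∀ Π → ⟦ isBad Π ⟧ ≤ ∑ Xs (λ X → ⟦ admissible X ⟧ * ⟦ matches (leaves X) Π (classes X) ⟧)
    bad≤ Π = ⟦⟧≤ (isBad Π) λ bad → let X , hX = bad-colouring Π bad in ≤-trans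
      (≤-reflexive (trans (cong ⟦_⟧ (sym hX)) (⟦∧⟧ (admissible X) _)))
      (term≤∑-allSubsets X (λ X → ⟦ admissible X ⟧ * ⟦ matches (leaves X) Π (classes X) ⟧))

-- There are n! bijections, so this says that the probability of failure is eventually at most
-- 1/(k+1), for every `k`: the o(1) claim without division.
theorem1 : ∀ (k : ℕ) → ∃[ N ] ∀ (n : ℕ) → N ≤ n → suc k * badCount n ≤ n !
-- The threshold is that of `C2-gain`; the cancelled factor is the number of possible flip counts.
theorem1 k = 4 * k + 6 , λ n n-large → let open Colouring n in *-cancelˡ-≤ (suc (2 * n)) (begin
  suc (2 * n) * (suc k * badCount n)
    ≡⟨ rearrange (suc (2 * n)) (suc k) (badCount n) ⟩
  suc k * suc (2 * n) * badCount n
    ≤⟨ *-monoʳ-≤ (suc k * suc (2 * n)) badCount≤∑weight ⟩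
  suc k * suc (2 * n) * ∑ (allSubsets (2 * n)) weight
    ≤⟨ flips-weighted-sum (suc k * suc (2 * n)) weight (gain-weight k n-large) ⟩
  suc (2 * n) * n ! ∎)
  where
  open ≤-Reasoning
  rearrange : ∀ a b c → a * (b * c) ≡ b * a * c
  rearrange = solve-∀
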